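{- For every nonnegative integer $n$, $$pod(n)=\sum_{j=0}^{\infty}a\!\left(\frac n2-\frac{j(j+1)}{4}\right),$$ where $a(x)=0$ if $x$ is not an integer.
   Context: $pod(n)$ denotes the number of partitions of $n$ in which odd parts are distinct and even parts may be repeated, with $pod(0)=1$. $a(n)$ is the cubic partition function: the number of partitions of $n$ in which the even parts can appear in two colors, with $a(0)=1$ and $a(x)=0$ for $x<0$; its generating function is $\sum_{n\ge0}a(n)q^n=\prod_{k\ge1}\frac{1}{(1-q^k)(1-q^{2k})}$. -}

module Defs where

open import Data.Fin.Base as Fin using (Fin; zero)
import Data.Fin.Properties as Fin
open import Data.Integer.Base using (+_)
open import Data.List.Base
  using (List; []; _∷_; length; map; filter; upTo; applyUpTo; allFin; cartesianProduct; cartesianProductWith)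
open import Data.List.Membership.Propositional using (_∈_)
open import Data.List.Membership.Propositional.Properties
  using (∈-cartesianProduct⁺; ∈-cartesianProductWith⁺; ∈-cartesianProductWith⁻; ∈-filter⁺; ∈-upTo⁺; ∈-allFin)
open import Data.List.Properties using (length-map; ∷-injective)
open import Data.List.Relation.Unary.All as All using (All; []; _∷_)
import Data.List.Relation.Unary.All.Properties as All
open import Data.List.Relation.Unary.AllPairs using ([]; _∷_)
open import Data.List.Relation.Unary.Any using (here; there)
open import Data.List.Relation.Unary.Linked using (Linked; linked?)
open import Data.List.Relation.Unary.Unique.Propositional using (Unique)
import Data.List.Relation.Unary.Unique.Propositional.Properties as Unique
open import Data.Nat.Base using (ℕ; suc; _+_; _≤_; _≥_; _<_; _>_; z≤n; s≤s)
open import Data.Nat.Divisibility using (_∣_; _∣?_)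
open import Data.Nat.ListAction using (sum)
open import Data.Nat.Properties using (_≟_; _≥?_; _<?_; _>?_; ≤-trans; +-mono-≤; m≤m+n; m≤n+m)
open import Data.List.Relation.Unary.Unique.DecPropositional _≟_ using (unique?)
open import Data.Product.Base using (∃; _×_; _,_; proj₁; proj₂)
open import Data.Product.Relation.Binary.Lex.Strict using (×-Lex; ×-decidable)
open import Data.Rational.Base using (ℚ; mkℚ)
open import Relation.Binary.Core using (Rel)
open import Relation.Binary.PropositionalEquality using (_≡_; refl; subst)
open import Relation.Nullary.Decidable using (¬?; _×-dec_; _→-dec_)
open import Relation.Nullary.Negation using (¬_)
open import Relation.Unary using (Decidable)

Odd : ℕ → Set
Odd n = ¬ 2 ∣ n

odd? : Decidable Odd
odd? n = ¬? (2 ∣? n)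

IsPartition : ℕ → List ℕ → Set
IsPartition n π = Linked _≥_ π × All (0 <_) π × sum π ≡ n

isPartition? : ∀ n → Decidable (IsPartition n)
isPartition? n π = linked? _≥?_ π ×-dec All.all? (0 <?_) π ×-dec (sum π ≟ n)

IsPodPartition : ℕ → List ℕ → Set
IsPodPartition n π = IsPartition n π × Unique (filter odd? π)

isPodPartition? : ∀ n → Decidable (IsPodPartition n)
isPodPartition? n π = isPartition? n π ×-dec unique? (filter odd? π)

ColouredPart : Set
ColouredPart = ℕ × Fin 2

size : ColouredPart → ℕ
size = proj₁

-- Only even parts have a choice of colour.
Admissible : ColouredPart → Set
Admissible (m , c) = Odd m → c ≡ zero

admissible? : Decidable Admissible
admissible? (m , c) = odd? m →-dec (c Fin.≟ zero)

-- Decreasing size, parts of equal size ordered by colour.  This is a total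
-- order, so each multiset of coloured parts is listed in exactly one way.
_≽_ : Rel ColouredPart _
_≽_ = ×-Lex _≡_ _>_ Fin._≥_

IsCubicPartition : ℕ → List ColouredPart → Set
IsCubicPartition n κ = Linked _≽_ κ × IsPartition n (map size κ) × All Admissible κ

isCubicPartition? : ∀ n → Decidable (IsCubicPartition n)
isCubicPartition? n κ =
  linked? (×-decidable _≟_ _>?_ (λ c d → d Fin.≤? c)) κ
    ×-dec isPartition? n (map size κ) ×-dec All.all? admissible? κ

-- All lists of length at most k with entries in xs.
lists : ∀ {A : Set} → List A → ℕ → List (List A)
lists xs 0       = [] ∷ []
lists xs (suc k) = [] ∷ cartesianProductWith _∷_ xs (lists xs k)

-- A partition of n has at most n parts, none exceeding n, so filtering the
-- lists of such shape finds all of them (see ∈-podPartitions and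
-- ∈-cubicPartitions), each once (see podPartitions-unique and
-- cubicPartitions-unique).
podPartitions : ℕ → List (List ℕ)
podPartitions n = filter (isPodPartition? n) (lists (upTo (suc n)) n)

cubicPartitions : ℕ → List (List ColouredPart)
cubicPartitions n =
  filter (isCubicPartition? n) (lists (cartesianProduct (upTo (suc n)) (allFin 2)) n)

pod : ℕ → ℕ
pod n = length (podPartitions n)

a : ℕ → ℕ
a n = length (cubicPartitions n)

-- The extension of a by zero.  As ℚ is kept in lowest terms, the first clause
-- covers precisely the nonnegative integers.
aℚ : ℚ → ℕ
aℚ (mkℚ (+ m) 0 _) = a m
aℚ _               = 0

-- Σ_{j ≥ 0} f j = s, for a series with finitely many nonzero terms: the
-- partial sums are eventually equal to s.
Σ∞_≈_ : (ℕ → ℕ) → ℕ → Set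
Σ∞ f ≈ s = ∃ λ N → ∀ M → N ≤ M → sum (applyUpTo f M) ≡ s

infix 4 Σ∞_≈_

private
  ∈-lists : ∀ {A : Set} {xs : List A} k {ys} → All (_∈ xs) ys → length ys ≤ k → ys ∈ lists xs k
  ∈-lists 0       []         z≤n     = here refl
  ∈-lists (suc k) []         z≤n     = here refl
  ∈-lists (suc k) (py ∷ pys) (s≤s l) = there (∈-cartesianProductWith⁺ _∷_ py (∈-lists k pys l))

  lists-unique : ∀ {A : Set} {xs : List A} k → Unique xs → Unique (lists xs k)
  lists-unique           0       u = [] ∷ []
  lists-unique {xs = xs} (suc k) u =
    All.tabulate nonempty
      ∷ Unique.cartesianProductWith⁺ _∷_ ∷-injective u (lists-unique k u)
    where
    nonempty : ∀ {ys} → ys ∈ cartesianProductWith _∷_ xs (lists xs k) → ¬ [] ≡ ys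
    nonempty ys∈ refl with ∈-cartesianProductWith⁻ _∷_ xs (lists xs k) ys∈
    ... | _ , _ , _ , _ , ()

  length≤sum : ∀ {π} → All (0 <_) π → length π ≤ sum π
  length≤sum []       = z≤n
  length≤sum (p ∷ ps) = +-mono-≤ p (length≤sum ps)

  parts≤sum : ∀ π → All (_≤ sum π) π
  parts≤sum []      = []
  parts≤sum (p ∷ π) = m≤m+n p (sum π) ∷ All.map (λ q≤ → ≤-trans q≤ (m≤n+m (sum π) p)) (parts≤sum π)

  length≤ : ∀ {n π} → IsPartition n π → length π ≤ n
  length≤ (_ , pos , refl) = length≤sum pos

  parts∈ : ∀ {n π} → IsPartition n π → All (_∈ upTo (suc n)) π
  parts∈ {π = π} (_ , _ , refl) = All.map (λ p≤ → ∈-upTo⁺ (s≤s p≤)) (parts≤sum π)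

∈-podPartitions : ∀ {n π} → IsPodPartition n π → π ∈ podPartitions n
∈-podPartitions {n} p@(part , _) =
  ∈-filter⁺ (isPodPartition? n) (∈-lists n (parts∈ part) (length≤ part)) p

podPartitions-unique : ∀ n → Unique (podPartitions n)
podPartitions-unique n =
  Unique.filter⁺ (isPodPartition? n) (lists-unique n (Unique.upTo⁺ (suc n)))

∈-cubicPartitions : ∀ {n κ} → IsCubicPartition n κ → κ ∈ cubicPartitions n
∈-cubicPartitions {n} {κ} p@(_ , part , _) =
  ∈-filter⁺ (isCubicPartition? n)
    (∈-lists n
      (All.map (λ {x} m∈ → ∈-cartesianProduct⁺ m∈ (∈-allFin (proj₂ x))) (All.map⁻ (parts∈ part)))
      (subst (_≤ n) (length-map size κ) (length≤ part)))
    p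

cubicPartitions-unique : ∀ n → Unique (cubicPartitions n)
cubicPartitions-unique n =
  Unique.filter⁺ (isCubicPartition? n)
    (lists-unique n (Unique.cartesianProduct⁺ (Unique.upTo⁺ (suc n)) (Unique.allFin⁺ 2)))

{-# OPTIONS --safe #-}
module Submission where

-- In generating functions the claim is
--   Π (1 + q^(2k−1)) / (1 − q^(2k)) = Σ_j q^(j(j+1)/2) · Π 1 / ((1 − q^(2k)) (1 − q^(4k))),
-- which is the Jacobi triple product in the form
--   Π (1 + q^(2k−1)) (1 − q^(4k)) = Σ_j q^(j(j+1)/2).
-- The finite version used here is
--   Π_{k ≤ 2m} (1 + q^(2k−1)) = Σ_{k ≤ 2m} q^(i(2i−1)) [2m, k]_{q^4},  i = k − m,
-- obtained by adding one factor at a time with the two q-Pascal rules.  As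
-- m → ∞ the binomials tend to Π 1 / (1 − q^(4k)), and i(2i−1) runs over the
-- triangular numbers.  Both sides are multiplied by the series of partitions
-- into even parts from the start, so that every coefficient is a natural number.

open import Defs
open import Data.Empty using (⊥-elim)
import Data.Empty.Irrelevant as Irrelevant
open import Data.Fin.Base using (zero; suc)
import Data.Fin.Properties as Fin
open import Data.List.Base using (List; []; _∷_; _++_; applyUpTo; map; length; filter)
open import Data.List.Properties using (length-map; length-++; ∷-injectiveʳ; filter-accept; filter-reject)
open import Data.List.Membership.Propositional using (_∈_)
open import Data.List.Membership.Propositional.Properties
  using (∈-++⁺ˡ; ∈-++⁺ʳ; ∈-++⁻; ∈-map⁺; ∈-map⁻; ∈-filter⁺; ∈-filter⁻)
open import Data.List.Membership.Propositional.Properties.WithK using (unique∧set⇒bag)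
open import Data.List.Relation.Binary.BagAndSetEquality using (∼bag⇒↭)
open import Data.List.Relation.Binary.Permutation.Propositional.Properties using (↭-length)
open import Data.List.Relation.Unary.All as All using (All; []; _∷_)
import Data.List.Relation.Unary.All.Properties as All
open import Data.List.Relation.Unary.AllPairs using ([]; _∷_)
open import Data.List.Relation.Unary.Any using (here)
open import Data.List.Relation.Unary.Linked as Linked using (Linked; []; [-]; _∷_)
open import Data.List.Relation.Unary.Linked.Properties using (Linked⇒All)
open import Data.List.Relation.Unary.Unique.Propositional using (Unique)
import Data.List.Relation.Unary.Unique.Propositional.Properties as Unique
open import Data.Nat.Base using (ℕ; zero; suc; _+_; _*_; _∸_; _≤_; _<_; _≥_; z≤n; s≤s; NonZero; >-nonZero⁻¹)
open import Data.Nat.Coprimality using (Coprime)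
open import Data.Nat.Divisibility using (_∣_; divides; ∣1⇒≡1; ∣m+n∣m⇒∣n; m∣m*n; ∣-refl)
open import Data.Nat.ListAction using (sum)
open import Data.Nat.Properties
open import Data.Nat.Tactic.RingSolver using (solve-∀)
open import Data.Product.Base using (_×_; _,_; proj₁; proj₂)
open import Data.Sum.Base using (_⊎_; inj₁; inj₂)
open import Function.Base using (_∘_; flip)
open import Function.Bundles using (mk⇔)
open import Relation.Binary.PropositionalEquality
open import Relation.Nullary.Decidable using (yes; no)
open import Relation.Nullary.Negation using (¬_)
open import Algebra.Properties.CommutativeSemigroup +-commutativeSemigroup using (interchange; x∙yz≈y∙xz)

-- No product of two series is ever formed. A factor is an operator on series (`shift`, `times1+`,
-- `geom`), and `binom`, `gaussLimit` and `oddProduct` carry the series f that they act on.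
-- Commutation of operators thus replaces commutativity of multiplication, and uniqueness of the
-- solution h of h = f + q^k h replaces cancelling 1 - q^k, which has no meaning over ℕ. Infinite
-- products do not occur either: each series is truncated at a level m, and the coefficient of q^n
-- is compared at m = 2n, where every truncation involved is already exact. The argument n/2 -
-- j(j+1)/4 is half of n - T, with T = j(j+1)/2. So the j-th summand is the coefficient of q^n in
-- q^T a(q^2), and rational numbers can wait until the end.

-- Power series with natural coefficients and operators on them

Series : Set
Series = ℕ → ℕ

infixl 6 _⊕_
_⊕_ : Series → Series → Series
(f ⊕ g) n = f n + g n

δ : Series
δ zero    = 1
δ (suc _) = 0

shift : ℕ → Series → Series
shift zero    f n       = f n
shift (suc k) f zero    = 0
shift (suc k) f (suc n) = shift k f n

shift-cong : ∀ k {f g} → f ≗ g → shift k f ≗ shift k g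
shift-cong zero    f≗g n       = f≗g n
shift-cong (suc k) f≗g zero    = refl
shift-cong (suc k) f≗g (suc n) = shift-cong k f≗g n

shift-⊕ : ∀ k f g → shift k (f ⊕ g) ≗ shift k f ⊕ shift k g
shift-⊕ zero    f g n       = refl
shift-⊕ (suc k) f g zero    = refl
shift-⊕ (suc k) f g (suc n) = shift-⊕ k f g n

shift-0 : ∀ k → shift k (λ _ → 0) ≗ λ _ → 0
shift-0 zero    n       = refl
shift-0 (suc k) zero    = refl
shift-0 (suc k) (suc n) = shift-0 k n

shift-shift : ∀ j k f → shift j (shift k f) ≗ shift (j + k) f
shift-shift zero    k f n       = refl
shift-shift (suc j) k f zero    = refl
shift-shift (suc j) k f (suc n) = shift-shift j k f n

shift-comm : ∀ j k f → shift j (shift k f) ≗ shift k (shift j f)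
shift-comm j k f n = begin
  shift j (shift k f) n  ≡⟨ shift-shift j k f n ⟩
  shift (j + k) f n      ≡⟨ cong (λ i → shift i f n) (+-comm j k) ⟩
  shift (k + j) f n      ≡⟨ shift-shift k j f n ⟨
  shift k (shift j f) n  ∎
  where open ≡-Reasoning

shift-+ : ∀ k f n → shift k f (k + n) ≡ f n
shift-+ zero    f n = refl
shift-+ (suc k) f n = shift-+ k f n

shift-< : ∀ {k n} f → n < k → shift k f n ≡ 0
shift-< {suc k} {zero}  f n<k       = refl
shift-< {suc k} {suc n} f (s≤s n<k) = shift-< f n<k

shift-local : ∀ k {f g n} → (∀ m → k + m ≡ n → f m ≡ g m) → shift k f n ≡ shift k g n
shift-local zero            f≡g = f≡g _ refl
shift-local (suc k) {n = zero}  f≡g = refl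
shift-local (suc k) {n = suc n} f≡g = shift-local k λ m eq → f≡g m (cong suc eq)

-- A positive shift reads only coefficients strictly below n. This makes every recursion through
-- `shift k` well founded.
shift-local-< : ∀ k .{{_ : NonZero k}} {f g n} →
                (∀ m → m < n → f m ≡ g m) → shift k f n ≡ shift k g n
shift-local-< (suc k) f≡g =
  shift-local (suc k) λ m eq → f≡g m (≤-trans (s≤s (m≤n+m m k)) (≤-reflexive eq))

-- geom k f is f / (1 - q^k).
geomUpTo : ℕ → ℕ → Series → Series
geomUpTo zero    k f = f
geomUpTo (suc u) k f = f ⊕ shift k (geomUpTo u k f)

geom : ℕ → Series → Series
geom k f n = geomUpTo n k f n

-- The terms omitted from 1 + q^k + ... + q^(uk) start beyond q^u because k ≥ 1. Hence taking n
-- steps for the coefficient of q^n in `geom` is enough, and any larger number gives the same.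
geomUpTo-stable : ∀ u v k .{{_ : NonZero k}} f {n} → n ≤ u → n ≤ v →
                  geomUpTo u k f n ≡ geomUpTo v k f n
geomUpTo-stable zero    zero    k       f n≤u n≤v = refl
geomUpTo-stable zero    (suc v) (suc k) f {zero} n≤u n≤v = sym (+-identityʳ (f 0))
geomUpTo-stable (suc u) zero    (suc k) f {zero} n≤u n≤v = +-identityʳ (f 0)
geomUpTo-stable (suc u) (suc v) k       f {n} n≤u n≤v = cong (f n +_) (shift-local-< k λ m m<n →
  geomUpTo-stable u v k f (≤-pred (≤-trans m<n n≤u)) (≤-pred (≤-trans m<n n≤v)))

geom-unfold : ∀ k .{{_ : NonZero k}} f → geom k f ≗ f ⊕ shift k (geom k f)
geom-unfold k f n = begin
  geom k f n                             ≡⟨ geomUpTo-stable n (suc n) k f ≤-refl (n≤1+n n) ⟩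
  f n + shift k (geomUpTo n k f) n       ≡⟨ cong (f n +_) (shift-local-< k λ m m<n → geomUpTo-stable n m k f (<⇒≤ m<n) ≤-refl) ⟩
  f n + shift k (geom k f) n             ∎
  where open ≡-Reasoning

-- The equation determines each coefficient of h from earlier ones. All later identities about
-- `geom` are proved by checking this equation.
geom-unique : ∀ k .{{_ : NonZero k}} {f h} → h ≗ f ⊕ shift k h → h ≗ geom k f
geom-unique k {f} {h} eq n = go (suc n) n ≤-refl
  where
  open ≡-Reasoning
  go : ∀ u n → n < u → h n ≡ geom k f n
  go (suc u) n (s≤s n≤u) = begin
    h n                         ≡⟨ eq n ⟩
    f n + shift k h n           ≡⟨ cong (f n +_) (shift-local-< k λ m m<n → go u m (≤-trans m<n n≤u)) ⟩
    f n + shift k (geom k f) n  ≡⟨ geom-unfold k f n ⟨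
    geom k f n                  ∎

geom-cong : ∀ k .{{_ : NonZero k}} {f g} → f ≗ g → geom k f ≗ geom k g
geom-cong k {f} {g} f≗g = geom-unique k λ n →
  trans (geom-unfold k f n) (cong (_+ shift k (geom k f) n) (f≗g n))

-- An operator that is additive and commutes with shift k commutes with
-- geom k, because the image of geom k f solves the defining equation.
geom-comm : ∀ k .{{_ : NonZero k}} (L : Series → Series) →
            (∀ {f g} → f ≗ g → L f ≗ L g) →
            (∀ f g → L (f ⊕ g) ≗ L f ⊕ L g) →
            (∀ f → L (shift k f) ≗ shift k (L f)) →
            ∀ f → L (geom k f) ≗ geom k (L f)
geom-comm k L L-cong L-⊕ L-shift f = geom-unique k λ n → begin
  L (geom k f) n                        ≡⟨ L-cong (geom-unfold k f) n ⟩
  L (f ⊕ shift k (geom k f)) n          ≡⟨ L-⊕ f (shift k (geom k f)) n ⟩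
  L f n + L (shift k (geom k f)) n      ≡⟨ cong (L f n +_) (L-shift (geom k f) n) ⟩
  L f n + shift k (L (geom k f)) n      ∎
  where open ≡-Reasoning

geom-⊕ : ∀ k .{{_ : NonZero k}} f g → geom k (f ⊕ g) ≗ geom k f ⊕ geom k g
geom-⊕ k f g n = sym (geom-unique k {f ⊕ g} {geom k f ⊕ geom k g} (λ m → begin
  geom k f m + geom k g m
    ≡⟨ cong₂ _+_ (geom-unfold k f m) (geom-unfold k g m) ⟩
  (f m + shift k (geom k f) m) + (g m + shift k (geom k g) m)
    ≡⟨ interchange (f m) _ (g m) _ ⟩
  (f m + g m) + (shift k (geom k f) m + shift k (geom k g) m)
    ≡⟨ cong (f m + g m +_) (shift-⊕ k (geom k f) (geom k g) m) ⟨
  (f m + g m) + shift k (geom k f ⊕ geom k g) m  ∎) n)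
  where open ≡-Reasoning

geom-shift : ∀ k .{{_ : NonZero k}} j f → geom k (shift j f) ≗ shift j (geom k f)
geom-shift k j f n =
  sym (geom-comm k (shift j) (shift-cong j) (shift-⊕ j) (λ g → shift-comm j k g) f n)

geom-geom : ∀ j k .{{_ : NonZero j}} .{{_ : NonZero k}} f → geom j (geom k f) ≗ geom k (geom j f)
geom-geom j k = geom-comm k (geom j) (geom-cong j) (geom-⊕ j) (geom-shift j k)

times1+ : ℕ → Series → Series
times1+ k f = f ⊕ shift k f

times1+-cong : ∀ k {f g} → f ≗ g → times1+ k f ≗ times1+ k g
times1+-cong k f≗g n = cong₂ _+_ (f≗g n) (shift-cong k f≗g n)

geom-times1+ : ∀ k .{{_ : NonZero k}} j f → geom k (times1+ j f) ≗ times1+ j (geom k f)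
geom-times1+ k j f n =
  trans (geom-⊕ k f (shift j f) n) (cong (geom k f n +_) (geom-shift k j f n))

-- Finite sums

∑ : ℕ → (ℕ → ℕ) → ℕ
∑ K f = sum (applyUpTo f K)

∑-cong : ∀ K {f g} → (∀ k → k < K → f k ≡ g k) → ∑ K f ≡ ∑ K g
∑-cong zero    f≡g = refl
∑-cong (suc K) f≡g = cong₂ _+_ (f≡g 0 (s≤s z≤n)) (∑-cong K λ k k<K → f≡g (suc k) (s≤s k<K))

∑-+ : ∀ K f g → ∑ K (λ k → f k + g k) ≡ ∑ K f + ∑ K g
∑-+ zero    f g = refl
∑-+ (suc K) f g = trans (cong (f 0 + g 0 +_) (∑-+ K (f ∘ suc) (g ∘ suc)))
                        (interchange (f 0) (g 0) _ _)

∑-last : ∀ K f → ∑ (suc K) f ≡ ∑ K f + f K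
∑-last zero    f = +-identityʳ (f 0)
∑-last (suc K) f = trans (cong (f 0 +_) (∑-last K (f ∘ suc))) (sym (+-assoc (f 0) _ _))

∑-truncate : ∀ {K M} f → K ≤ M → (∀ k → K ≤ k → f k ≡ 0) → ∑ M f ≡ ∑ K f
∑-truncate {M = zero}  f z≤n f≡0 = refl
∑-truncate {M = suc M} f z≤n f≡0 =
  cong₂ _+_ (f≡0 0 z≤n) (∑-truncate {M = M} (f ∘ suc) z≤n λ k _ → f≡0 (suc k) z≤n)
∑-truncate f (s≤s K≤M) f≡0 =
  cong (f 0 +_) (∑-truncate (f ∘ suc) K≤M λ k K≤k → f≡0 (suc k) (s≤s K≤k))

shift-∑ : ∀ j K (F : ℕ → Series) → shift j (λ n → ∑ K (λ k → F k n)) ≗ λ n → ∑ K (λ k → shift j (F k) n)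
shift-∑ j zero    F n = shift-0 j n
shift-∑ j (suc K) F n = trans (shift-⊕ j (F 0) _ n) (cong (shift j (F 0) n +_) (shift-∑ j K (F ∘ suc) n))

-- Gaussian binomials and the finite triple product

-- binom f N k is f times the Gaussian binomial coefficient [N, k] in q^4.
binom : Series → ℕ → ℕ → Series
binom f N       zero    = f
binom f zero    (suc k) = λ _ → 0
binom f (suc N) (suc k) = binom f N k ⊕ shift (4 + 4 * k) (binom f N (suc k))

binom-> : ∀ f {N k} → N < k → binom f N k ≗ λ _ → 0
binom-> f {zero}  {suc k} _         n = refl
binom-> f {suc N} {suc k} (s≤s N<k) n = cong₂ _+_ (binom-> f N<k n)
  (trans (shift-cong (4 + 4 * k) (binom-> f (m<n⇒m<1+n N<k)) n) (shift-0 (4 + 4 * k) n))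

-- The q-Pascal rule dual to the defining one. In the inductive step both terms of the defining rule
-- are expanded by the dual rule for a smaller N; after regrouping, each pair folds back by the
-- defining rule.
binom-pascal : ∀ f {N k} → k ≤ N →
               binom f (suc N) (suc k) ≗ binom f N (suc k) ⊕ shift (4 * (N ∸ k)) (binom f N k)
binom-pascal f {zero} {zero} _ n = trans (cong (f n +_) (shift-0 4 n)) (+-identityʳ (f n))
binom-pascal f {suc N} {zero} _ n = begin
  f n + shift 4 (binom f (suc N) 1) n
    ≡⟨ cong (f n +_) (shift-cong 4 (binom-pascal f {N} z≤n) n) ⟩
  f n + shift 4 (binom f N 1 ⊕ shift (4 * N) f) n
    ≡⟨ cong (f n +_) (shift-⊕ 4 (binom f N 1) _ n) ⟩
  f n + (shift 4 (binom f N 1) n + shift 4 (shift (4 * N) f) n)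
    ≡⟨ +-assoc (f n) _ _ ⟨
  f n + shift 4 (binom f N 1) n + shift 4 (shift (4 * N) f) n
    ≡⟨ cong (f n + shift 4 (binom f N 1) n +_) (trans (shift-shift 4 (4 * N) f n) (cong (λ i → shift i f n) (sym (*-suc 4 N)))) ⟩
  f n + shift 4 (binom f N 1) n + shift (4 * suc N) f n  ∎
  where open ≡-Reasoning
binom-pascal f {suc N} {suc k} (s≤s k≤N) n = begin
  binom f (suc N) (suc k) n + shift j₁ (binom f (suc N) (suc (suc k))) n
    ≡⟨ cong₂ _+_ (binom-pascal f k≤N n) second ⟩
  (A + shift d (binom f N k) n) + (B + shift d (shift j₀ (binom f N (suc k))) n)
    ≡⟨ interchange A _ B _ ⟩
  (A + B) + (shift d (binom f N k) n + shift d (shift j₀ (binom f N (suc k))) n)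
    ≡⟨ cong (A + B +_) (shift-⊕ d (binom f N k) _ n) ⟨
  (A + B) + shift d (binom f (suc N) (suc k)) n  ∎
  where
  open ≡-Reasoning
  d j₀ j₁ A B : ℕ
  d = 4 * (N ∸ k)
  j₀ = 4 + 4 * k
  j₁ = 4 + 4 * suc k
  A = binom f N (suc k) n
  B = shift j₁ (binom f N (suc (suc k))) n
  second : shift j₁ (binom f (suc N) (suc (suc k))) n ≡ B + shift d (shift j₀ (binom f N (suc k))) n
  second with m≤n⇒m<n∨m≡n k≤N
  ... | inj₁ k<N = begin
    shift j₁ (binom f (suc N) (suc (suc k))) n
      ≡⟨ shift-cong j₁ (binom-pascal f k<N) n ⟩
    shift j₁ (binom f N (suc (suc k)) ⊕ shift (4 * (N ∸ suc k)) (binom f N (suc k))) n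
      ≡⟨ shift-⊕ j₁ (binom f N (suc (suc k))) _ n ⟩
    B + shift j₁ (shift (4 * (N ∸ suc k)) (binom f N (suc k))) n
      ≡⟨ cong (B +_) (shift-shift j₁ (4 * (N ∸ suc k)) (binom f N (suc k)) n) ⟩
    B + shift (j₁ + 4 * (N ∸ suc k)) (binom f N (suc k)) n
      ≡⟨ cong (λ i → B + shift i (binom f N (suc k)) n) (trans (lemma k (N ∸ suc k)) (cong (λ i → 4 * i + j₀) (sym (+-∸-assoc 1 k<N)))) ⟩
    B + shift (d + j₀) (binom f N (suc k)) n
      ≡⟨ cong (B +_) (shift-shift d j₀ (binom f N (suc k)) n) ⟨
    B + shift d (shift j₀ (binom f N (suc k))) n  ∎
    where
    lemma : ∀ k x → 4 + 4 * suc k + 4 * x ≡ 4 * (1 + x) + (4 + 4 * k)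
    lemma = solve-∀
  ... | inj₂ refl = begin
    shift j₁ (binom f (suc N) (suc (suc k))) n
      ≡⟨ shift-cong j₁ (binom-> f {suc N} {suc (suc N)} ≤-refl) n ⟩
    shift j₁ (λ _ → 0) n
      ≡⟨ shift-cong j₁ (binom-> f {N} {suc (suc N)} (n≤1+n (suc N))) n ⟨
    B
      ≡⟨ +-identityʳ B ⟨
    B + 0
      ≡⟨ cong (B +_) (trans (shift-shift d j₀ (binom f N (suc k)) n) (trans (shift-cong (d + j₀) (binom-> f {N} ≤-refl) n) (shift-0 (d + j₀) n))) ⟨
    B + shift d (shift j₀ (binom f N (suc k))) n  ∎

-- f / ((1 - q^4)(1 - q^8) ... (1 - q^(4k))), the limit of `binom f N k` as N grows.
gaussLimit : Series → ℕ → Series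
gaussLimit f zero    = f
gaussLimit f (suc k) = geom (4 + 4 * k) (gaussLimit f k)

-- Forgetting N turns the defining rule of `binom` into the equation of `geom`. One term of the rule
-- lowers N and k together, the other lowers N and n, so the bound k + n ≤ N survives the recursion.
binom-stable : ∀ f N k n → k + n ≤ N → binom f N k n ≡ gaussLimit f k n
binom-stable f N       zero    n _           = refl
binom-stable f (suc N) (suc k) n (s≤s k+n≤N) = begin
  binom f N k n + shift (4 + 4 * k) (binom f N (suc k)) n
    ≡⟨ cong₂ _+_ (binom-stable f N k n k+n≤N) (shift-local-< (4 + 4 * k) λ m m<n →
         binom-stable f N (suc k) m (≤-trans (≤-reflexive (sym (+-suc k m))) (≤-trans (+-monoʳ-≤ k m<n) k+n≤N))) ⟩
  gaussLimit f k n + shift (4 + 4 * k) (gaussLimit f (suc k)) n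
    ≡⟨ geom-unfold (4 + 4 * k) (gaussLimit f k) n ⟨
  gaussLimit f (suc k) n  ∎
  where open ≡-Reasoning

-- A factor 1 / (1 - q^(4i)) with 4i > n leaves the coefficient of q^n alone. From k = n on, that
-- coefficient is the one for the infinite product.
gaussLimit-stable : ∀ f k n → n ≤ k → gaussLimit f k n ≡ gaussLimit f n n
gaussLimit-stable f zero    zero n≤k = refl
gaussLimit-stable f (suc k) n n≤1+k with m≤n⇒m<n∨m≡n n≤1+k
... | inj₂ refl      = refl
... | inj₁ (s≤s n≤k) = begin
  gaussLimit f (suc k) n
    ≡⟨ geom-unfold (4 + 4 * k) (gaussLimit f k) n ⟩
  gaussLimit f k n + shift (4 + 4 * k) (gaussLimit f (suc k)) n
    ≡⟨ cong (gaussLimit f k n +_) (shift-< _ n<4+4k) ⟩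
  gaussLimit f k n + 0
    ≡⟨ +-identityʳ _ ⟩
  gaussLimit f k n
    ≡⟨ gaussLimit-stable f k n n≤k ⟩
  gaussLimit f n n  ∎
  where
  open ≡-Reasoning
  n<4+4k : n < 4 + 4 * k
  n<4+4k = s≤s (≤-trans n≤k (≤-trans (m≤m+n k (3 * k)) (m≤n+m (4 * k) 3)))

-- The exponents i (2i - 1) as triangular numbers

triangular : ℕ → ℕ
triangular zero    = 0
triangular (suc n) = suc n + triangular n

n≤triangular : ∀ n → n ≤ triangular n
n≤triangular zero    = z≤n
n≤triangular (suc n) = m≤m+n (suc n) (triangular n)

-- For i = k − r, zigzag r k is 2i − 1 if i > 0 and −2i otherwise; its
-- triangular number is i (2i − 1) in both cases.
zigzag : ℕ → ℕ → ℕ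
zigzag zero    zero    = 0
zigzag zero    (suc k) = 1 + 2 * k
zigzag (suc r) zero    = 2 + 2 * r
zigzag (suc r) (suc k) = zigzag r k

exponent : ℕ → ℕ → ℕ
exponent r k = triangular (zigzag r k)

-- With i = k - r this is (i + 1)(2i + 1) - i(2i - 1) = 4i + 1, cleared of subtraction.
exponent-suc : ∀ r k → exponent r (suc k) + 4 * r ≡ exponent r k + (1 + 4 * k)
exponent-suc zero zero = refl
exponent-suc zero (suc k) = begin
  triangular (1 + 2 * suc k) + 0          ≡⟨ cong (λ i → triangular (1 + i) + 0) (*-suc 2 k) ⟩
  triangular (3 + 2 * k) + 0              ≡⟨ lemma k (triangular (1 + 2 * k)) ⟩
  triangular (1 + 2 * k) + (1 + 4 * suc k)  ∎
  where
  open ≡-Reasoning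
  lemma : ∀ k t → 3 + 2 * k + (2 + 2 * k + t) + 0 ≡ t + (1 + 4 * (1 + k))
  lemma = solve-∀
exponent-suc (suc zero) zero = refl
exponent-suc (suc (suc r)) zero = begin
  triangular (2 + 2 * r) + 4 * suc (suc r)   ≡⟨ lemma r (triangular (2 + 2 * r)) ⟩
  triangular (4 + 2 * r) + 1                 ≡⟨ cong (λ i → triangular (2 + i) + 1) (*-suc 2 r) ⟨
  triangular (2 + 2 * suc r) + 1             ∎
  where
  open ≡-Reasoning
  lemma : ∀ r t → t + 4 * (2 + r) ≡ 4 + 2 * r + (3 + 2 * r + t) + 1
  lemma = solve-∀
exponent-suc (suc r) (suc k) = begin
  exponent r (suc k) + 4 * suc r        ≡⟨ lemma₁ (exponent r (suc k)) r ⟩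
  exponent r (suc k) + 4 * r + 4        ≡⟨ cong (_+ 4) (exponent-suc r k) ⟩
  exponent r k + (1 + 4 * k) + 4        ≡⟨ lemma₂ (exponent r k) k ⟩
  exponent r k + (1 + 4 * suc k)        ∎
  where
  open ≡-Reasoning
  lemma₁ : ∀ x r → x + 4 * (1 + r) ≡ x + 4 * r + 4
  lemma₁ = solve-∀
  lemma₂ : ∀ x k → x + (1 + 4 * k) + 4 ≡ x + (1 + 4 * (1 + k))
  lemma₂ = solve-∀

-- |i| ≤ i(2i - 1) for every integer i; this bound and `r≤k+exponent` are its two halves.
k≤r+exponent : ∀ r k → k ≤ r + exponent r k
k≤r+exponent zero    zero    = z≤n
k≤r+exponent zero    (suc k) = ≤-trans (s≤s (m≤m+n k (k + 0))) (n≤triangular (1 + 2 * k))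
k≤r+exponent (suc r) zero    = z≤n
k≤r+exponent (suc r) (suc k) = s≤s (k≤r+exponent r k)

r≤k+exponent : ∀ r k → r ≤ k + exponent r k
r≤k+exponent zero    k       = z≤n
r≤k+exponent (suc r) zero    = ≤-trans (s≤s (≤-trans (m≤m+n r (r + 0)) (n≤1+n _))) (n≤triangular (2 + 2 * r))
r≤k+exponent (suc r) (suc k) = s≤s (r≤k+exponent r k)

-- On 0, ..., 2r the map `zigzag r` is a permutation: raising r by one adds the value 2 + 2r at the
-- front and 1 + 2r at the end.
∑-zigzag : ∀ r (g : ℕ → ℕ) → ∑ (1 + 2 * r) (g ∘ zigzag r) ≡ ∑ (1 + 2 * r) g
∑-zigzag zero    g = refl
∑-zigzag (suc r) g = begin
  ∑ (1 + 2 * suc r) (g ∘ zigzag (suc r))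
    ≡⟨ cong (λ i → ∑ (1 + i) (g ∘ zigzag (suc r))) (*-suc 2 r) ⟩
  g (2 + 2 * r) + ∑ (2 + 2 * r) (g ∘ zigzag r)
    ≡⟨ cong (g (2 + 2 * r) +_) (∑-last (1 + 2 * r) (g ∘ zigzag r)) ⟩
  g (2 + 2 * r) + (∑ (1 + 2 * r) (g ∘ zigzag r) + g (zigzag r (1 + 2 * r)))
    ≡⟨ cong (g (2 + 2 * r) +_) (cong₂ _+_ (∑-zigzag r g) (cong g (zigzag-end r))) ⟩
  g (2 + 2 * r) + (∑ (1 + 2 * r) g + g (1 + 2 * r))
    ≡⟨ cong (g (2 + 2 * r) +_) (∑-last (1 + 2 * r) g) ⟨
  g (2 + 2 * r) + ∑ (2 + 2 * r) g
    ≡⟨ +-comm (g (2 + 2 * r)) _ ⟩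
  ∑ (2 + 2 * r) g + g (2 + 2 * r)
    ≡⟨ ∑-last (2 + 2 * r) g ⟨
  ∑ (3 + 2 * r) g
    ≡⟨ cong (λ i → ∑ (1 + i) g) (*-suc 2 r) ⟨
  ∑ (1 + 2 * suc r) g  ∎
  where
  open ≡-Reasoning
  zigzag-+ : ∀ r k → zigzag r (r + suc k) ≡ 1 + 2 * k
  zigzag-+ zero    k = refl
  zigzag-+ (suc r) k = zigzag-+ r k
  zigzag-end : ∀ r → zigzag r (1 + 2 * r) ≡ 1 + 2 * r
  zigzag-end r = trans (cong (zigzag r) (lemma r)) (zigzag-+ r r)
    where
    lemma : ∀ r → 1 + 2 * r ≡ r + (1 + r)
    lemma = solve-∀

-- Adding one odd factor to the finite triple product

-- The centre r is independent of N so that factors can be added singly: r counts the factors with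
-- exponent 3 mod 4, and N - r those with exponent 1 mod 4.
jacobi : Series → ℕ → ℕ → Series
jacobi f r N n = ∑ (suc N) λ k → shift (exponent r k) (binom f N k) n

module _ (f : Series) (r N : ℕ) where
  open ≡-Reasoning

  private
    term : ℕ → Series
    term k = shift (exponent r k) (binom f N k)

    -- The Pascal rules produce sums running to k = N + 1; that extra term is zero.
    ∑-term : ∀ n → ∑ (2 + N) (λ k → term k n) ≡ jacobi f r N n
    ∑-term n = begin
      ∑ (2 + N) (λ k → term k n)
        ≡⟨ ∑-last (1 + N) (λ k → term k n) ⟩
      jacobi f r N n + term (1 + N) n
        ≡⟨ cong (jacobi f r N n +_) (trans (shift-cong (exponent r (1 + N)) (binom-> f {N} ≤-refl) n) (shift-0 (exponent r (1 + N)) n)) ⟩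
      jacobi f r N n + 0
        ≡⟨ +-identityʳ _ ⟩
      jacobi f r N n  ∎

    ∑-shift-term : ∀ j n → ∑ (2 + N) (λ k → shift j (term k) n) ≡ shift j (jacobi f r N) n
    ∑-shift-term j n = trans (sym (shift-∑ j (2 + N) term n)) (shift-cong j ∑-term n)

    shift-split : ∀ {i} j k F n → i ≡ j + k → shift i F n ≡ shift j (shift k F) n
    shift-split j k F n refl = sym (shift-shift j k F n)

  -- The dual Pascal rule contributes q^(4(N - k)), and passing from k to k + 1 raises the exponent
  -- by 1 + 4(k - r). The total 1 + 4(N - r) does not depend on k, so it comes out of the sum as one
  -- factor.
  jacobi-sucʳ : ∀ d → N ≡ r + d → jacobi f r (suc N) ≗ times1+ (1 + 4 * d) (jacobi f r N)
  jacobi-sucʳ d N≡r+d n = begin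
    term 0 n + ∑ (1 + N) (λ k → shift (exponent r (suc k)) (binom f (suc N) (suc k)) n)
      ≡⟨ cong (term 0 n +_) (∑-cong (1 + N) λ { k (s≤s k≤N) → split k k≤N }) ⟩
    term 0 n + ∑ (1 + N) (λ k → term (suc k) n + shift (1 + 4 * d) (term k) n)
      ≡⟨ cong (term 0 n +_) (∑-+ (1 + N) (λ k → term (suc k) n) (λ k → shift (1 + 4 * d) (term k) n)) ⟩
    term 0 n + (∑ (1 + N) (λ k → term (suc k) n) + ∑ (1 + N) (λ k → shift (1 + 4 * d) (term k) n))
      ≡⟨ +-assoc (term 0 n) _ _ ⟨
    ∑ (2 + N) (λ k → term k n) + ∑ (1 + N) (λ k → shift (1 + 4 * d) (term k) n)
      ≡⟨ cong₂ _+_ (∑-term n) (sym (shift-∑ (1 + 4 * d) (1 + N) term n)) ⟩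
    times1+ (1 + 4 * d) (jacobi f r N) n  ∎
    where
    exponents : ∀ k → k ≤ N → exponent r (suc k) + 4 * (N ∸ k) ≡ 1 + 4 * d + exponent r k
    exponents k k≤N = +-cancelʳ-≡ (4 * k + 4 * r) _ _ (begin
      exponent r (suc k) + 4 * (N ∸ k) + (4 * k + 4 * r)
        ≡⟨ lemma₁ (exponent r (suc k)) (N ∸ k) k r ⟩
      (exponent r (suc k) + 4 * r) + 4 * (N ∸ k + k)
        ≡⟨ cong₂ (λ x y → x + 4 * y) (exponent-suc r k) (trans (m∸n+n≡m k≤N) N≡r+d) ⟩
      (exponent r k + (1 + 4 * k)) + 4 * (r + d)
        ≡⟨ lemma₂ (exponent r k) k r d ⟩
      1 + 4 * d + exponent r k + (4 * k + 4 * r)  ∎)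
      where
      lemma₁ : ∀ x y k r → x + 4 * y + (4 * k + 4 * r) ≡ (x + 4 * r) + 4 * (y + k)
      lemma₁ = solve-∀
      lemma₂ : ∀ x k r d → (x + (1 + 4 * k)) + 4 * (r + d) ≡ 1 + 4 * d + x + (4 * k + 4 * r)
      lemma₂ = solve-∀
    split : ∀ k → k ≤ N → shift (exponent r (suc k)) (binom f (suc N) (suc k)) n ≡
                          term (suc k) n + shift (1 + 4 * d) (term k) n
    split k k≤N = begin
      shift e (binom f (suc N) (suc k)) n
        ≡⟨ shift-cong e (binom-pascal f k≤N) n ⟩
      shift e (binom f N (suc k) ⊕ shift (4 * (N ∸ k)) (binom f N k)) n
        ≡⟨ shift-⊕ e (binom f N (suc k)) _ n ⟩
      term (suc k) n + shift e (shift (4 * (N ∸ k)) (binom f N k)) n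
        ≡⟨ cong (term (suc k) n +_) (trans (shift-shift e _ (binom f N k) n)
             (shift-split (1 + 4 * d) (exponent r k) (binom f N k) n (exponents k k≤N))) ⟩
      term (suc k) n + shift (1 + 4 * d) (term k) n  ∎
      where
      e : ℕ
      e = exponent r (suc k)

  -- Moving the centre along with k keeps the exponents, and here the defining Pascal rule is the
  -- one whose extra power of q combines to 3 + 4r for every k. The term k = 0 has no Pascal
  -- expansion; it supplies the missing first term of the shifted sum.
  jacobi-sucˡ : jacobi f (suc r) (suc N) ≗ times1+ (3 + 4 * r) (jacobi f r N)
  jacobi-sucˡ n = begin
    shift (exponent (suc r) 0) f n +
      ∑ (1 + N) (λ k → shift (exponent r k) (binom f (suc N) (suc k)) n)
      ≡⟨ cong₂ _+_ (shift-split (3 + 4 * r) (exponent r 0) f n (trans (sym (+-identityʳ _)) (exponents 0))) (∑-cong (1 + N) λ k _ → split k) ⟩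
    shift (3 + 4 * r) (term 0) n +
      ∑ (1 + N) (λ k → term k n + shift (3 + 4 * r) (term (suc k)) n)
      ≡⟨ cong (shift (3 + 4 * r) (term 0) n +_) (∑-+ (1 + N) (λ k → term k n) (λ k → shift (3 + 4 * r) (term (suc k)) n)) ⟩
    shift (3 + 4 * r) (term 0) n + (jacobi f r N n +
      ∑ (1 + N) (λ k → shift (3 + 4 * r) (term (suc k)) n))
      ≡⟨ x∙yz≈y∙xz (shift (3 + 4 * r) (term 0) n) (jacobi f r N n) _ ⟩
    jacobi f r N n + ∑ (2 + N) (λ k → shift (3 + 4 * r) (term k) n)
      ≡⟨ cong (jacobi f r N n +_) (∑-shift-term (3 + 4 * r) n) ⟩
    times1+ (3 + 4 * r) (jacobi f r N) n  ∎
    where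
    exponents : ∀ k → exponent (suc r) k + 4 * k ≡ 3 + 4 * r + exponent r k
    exponents k = suc-injective (begin
      suc (exponent (suc r) k + 4 * k)     ≡⟨ +-suc (exponent (suc r) k) (4 * k) ⟨
      exponent (suc r) k + (1 + 4 * k)     ≡⟨ exponent-suc (suc r) k ⟨
      exponent r k + 4 * suc r             ≡⟨ lemma (exponent r k) r ⟩
      suc (3 + 4 * r + exponent r k)       ∎)
      where
      lemma : ∀ x r → x + 4 * (1 + r) ≡ 1 + (3 + 4 * r + x)
      lemma = solve-∀
    split : ∀ k → shift (exponent r k) (binom f (suc N) (suc k)) n ≡
                  term k n + shift (3 + 4 * r) (term (suc k)) n
    split k = begin
      shift e (binom f N k ⊕ shift (4 + 4 * k) (binom f N (suc k))) n
        ≡⟨ shift-⊕ e (binom f N k) _ n ⟩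
      term k n + shift e (shift (4 + 4 * k) (binom f N (suc k))) n
        ≡⟨ cong (term k n +_) (trans (shift-shift e _ (binom f N (suc k)) n)
             (shift-split (3 + 4 * r) (exponent r (suc k)) (binom f N (suc k)) n
               (trans (cong (e +_) (sym (*-suc 4 k))) (exponents (suc k))))) ⟩
      term k n + shift (3 + 4 * r) (term (suc k)) n  ∎
      where
      e : ℕ
      e = exponent r k

-- Factors come in pairs so that the centre m stays in the middle of 0, ..., 2m and both tails of
-- the sum grow.
oddProduct : ℕ → Series → Series
oddProduct zero    f = f
oddProduct (suc m) f = times1+ (3 + 4 * m) (times1+ (1 + 4 * m) (oddProduct m f))

oddProduct-jacobi : ∀ m f → oddProduct m f ≗ jacobi f m (2 * m)
oddProduct-jacobi zero    f n = sym (+-identityʳ (f n))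
oddProduct-jacobi (suc m) f n = begin
  oddProduct (suc m) f n
    ≡⟨ times1+-cong (3 + 4 * m) (times1+-cong (1 + 4 * m) (oddProduct-jacobi m f)) n ⟩
  times1+ (3 + 4 * m) (times1+ (1 + 4 * m) (jacobi f m (2 * m))) n
    ≡⟨ times1+-cong (3 + 4 * m) (jacobi-sucʳ f m (2 * m) m (cong (m +_) (+-identityʳ m))) n ⟨
  times1+ (3 + 4 * m) (jacobi f m (1 + 2 * m)) n
    ≡⟨ jacobi-sucˡ f m (1 + 2 * m) n ⟨
  jacobi f (suc m) (2 + 2 * m) n
    ≡⟨ cong (λ N → jacobi f (suc m) N n) (*-suc 2 m) ⟨
  jacobi f (suc m) (2 * suc m) n  ∎
  where open ≡-Reasoning

-- The exponent of the k-th term is at least |m − k|, so a term contributing to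
-- the coefficient of q^n lies in the stable range of the binomials.
oddProduct-triangular : ∀ m f n → 2 * n ≤ m →
  oddProduct m f n ≡ ∑ (1 + 2 * m) λ j → shift (triangular j) (gaussLimit f m) n
oddProduct-triangular m f n 2n≤m = begin
  oddProduct m f n
    ≡⟨ oddProduct-jacobi m f n ⟩
  jacobi f m (2 * m) n
    ≡⟨ ∑-cong (1 + 2 * m) (λ k _ → shift-local (exponent m k) (stable k)) ⟩
  ∑ (1 + 2 * m) (λ k → shift (exponent m k) (gaussLimit f m) n)
    ≡⟨ ∑-zigzag m (λ j → shift (triangular j) (gaussLimit f m) n) ⟩
  ∑ (1 + 2 * m) (λ j → shift (triangular j) (gaussLimit f m) n)  ∎
  where
  open ≡-Reasoning
  module _ (k l : ℕ) (eq : exponent m k + l ≡ n) where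
    e≤n : exponent m k ≤ n
    e≤n = m+n≤o⇒m≤o _ (≤-reflexive eq)
    l≤n : l ≤ n
    l≤n = m+n≤o⇒n≤o (exponent m k) (≤-reflexive eq)
    n+n≤m : n + n ≤ m
    n+n≤m = ≤-trans (≤-reflexive (cong (n +_) (sym (+-identityʳ n)))) 2n≤m
    l≤m : l ≤ m
    l≤m = ≤-trans l≤n (m+n≤o⇒m≤o n n+n≤m)
    -- The reason for asking m ≥ 2n: k ≥ m - n ≥ n ≥ l.
    l≤k : l ≤ k
    l≤k = +-cancelʳ-≤ n l k (≤-trans (+-monoˡ-≤ n l≤n) (≤-trans n+n≤m
            (≤-trans (r≤k+exponent m k) (+-monoʳ-≤ k e≤n))))
    k+l≤2m : k + l ≤ 2 * m
    k+l≤2m = ≤-trans (+-monoˡ-≤ l (k≤r+exponent m k)) (≤-trans (≤-reflexive (+-assoc m _ l))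
               (+-monoʳ-≤ m (≤-trans (≤-reflexive eq) (≤-trans (m+n≤o⇒m≤o n n+n≤m) (m≤m+n m 0)))))
    stable : binom f (2 * m) k l ≡ gaussLimit f m l
    stable = trans (binom-stable f (2 * m) k l k+l≤2m)
      (trans (gaussLimit-stable f k l l≤k) (sym (gaussLimit-stable f m l l≤m)))

-- Enumeration of partitions by their largest part

record HasCount {X : Set} (P : X → Set) (c : ℕ) : Set where
  field
    elements : List X
    unique   : Unique elements
    sound    : ∀ {x} → x ∈ elements → P x
    complete : ∀ {x} → P x → x ∈ elements
    size≡    : length elements ≡ c

open HasCount

-- Two duplicate-free lists with the same members are permutations of each other. This compares the
-- filtered lists that define `pod` and `a` with the lists built recursively below.
HasCount-unique : ∀ {X : Set} {P : X → Set} {c d} → HasCount P c → HasCount P d → c ≡ d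
HasCount-unique h k = trans (sym (size≡ h)) (trans
  (↭-length (∼bag⇒↭ (unique∧set⇒bag (unique h) (unique k)
    (mk⇔ (complete k ∘ sound h) (complete h ∘ sound k)))))
  (size≡ k))

HasCount-⇔ : ∀ {X : Set} {P Q : X → Set} {c} →
             (∀ {x} → P x → Q x) → (∀ {x} → Q x → P x) → HasCount P c → HasCount Q c
HasCount-⇔ to from h = record
  { elements = elements h
  ; unique   = unique h
  ; sound    = to ∘ sound h
  ; complete = complete h ∘ from
  ; size≡    = size≡ h
  }

-- In generating functions, P + q^w Q.
data Decomposition {X : Set} (x : X) (w : ℕ) (P Q : ℕ → List X → Set) : ℕ → List X → Set where
  old : ∀ {n κ} → P n κ → Decomposition x w P Q n κ
  new : ∀ {n κ} → Q n κ → Decomposition x w P Q (w + n) (x ∷ κ)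

Decomposition-map : ∀ {X : Set} {x : X} {w P Q Q′} → (∀ {n κ} → Q n κ → Q′ n κ) →
                    ∀ {n κ} → Decomposition x w P Q n κ → Decomposition x w P Q′ n κ
Decomposition-map f (old p) = old p
Decomposition-map f (new q) = new (f q)

-- Taking Q = P allows x at most once and gives the factor 1 + q^w; taking Q = R allows repetition
-- and gives 1 / (1 - q^w). The field `fresh` makes the two cases of `split` disjoint.
record Adjoins {X : Set} (x : X) (w : ℕ) (P Q R : ℕ → List X → Set) : Set where
  field
    keep  : ∀ {n κ} → P n κ → R n κ
    cons  : ∀ {n κ} → Q n κ → R (w + n) (x ∷ κ)
    split : ∀ {n κ} → R n κ → Decomposition x w P Q n κ
    fresh : ∀ {n κ} → ¬ P n (x ∷ κ)

open Adjoins

module _ {X : Set} {x : X} {w : ℕ} {P Q R : ℕ → List X → Set} (adj : Adjoins x w P Q R) where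

  -- Q is asked about only at weights m with w + m ≡ n. In `geom-counts` Q is R itself, and this
  -- restriction makes its recursion descend.
  HasCount-adjoins : ∀ {n c} {g : Series} → HasCount (P n) c →
                     (∀ m → w + m ≡ n → HasCount (Q m) (g m)) →
                     HasCount (R n) (c + shift w g n)
  HasCount-adjoins {n} {c} {g} hP hQ with w ≤? n
  ... | no w≰n = record
    { elements = elements hP
    ; unique   = unique hP
    ; sound    = keep adj ∘ sound hP
    ; complete = λ r → complete hP (short r)
    ; size≡    = trans (size≡ hP) (sym (trans (cong (c +_) (shift-< g (≰⇒> w≰n))) (+-identityʳ c)))
    }
    where
    short : ∀ {κ} → R n κ → P n κ
    short r with split adj r
    ... | old p         = p
    ... | new {n = m} _ = ⊥-elim (w≰n (m≤m+n w m))
  ... | yes w≤n = record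
    { elements = elements hP ++ map (x ∷_) (elements h)
    ; unique   = Unique.++⁺ (unique hP) (Unique.map⁺ ∷-injectiveʳ (unique h)) disjoint
    ; sound    = λ κ∈ → sound′ (∈-++⁻ (elements hP) κ∈)
    ; complete = λ r → complete′ refl (split adj r)
    ; size≡    = begin
        length (elements hP ++ map (x ∷_) (elements h))
          ≡⟨ length-++ (elements hP) ⟩
        length (elements hP) + length (map (x ∷_) (elements h))
          ≡⟨ cong₂ _+_ (size≡ hP) (trans (length-map (x ∷_) (elements h)) (size≡ h)) ⟩
        c + g m
          ≡⟨ cong (c +_) (shift-+ w g m) ⟨
        c + shift w g (w + m)
          ≡⟨ cong (λ i → c + shift w g i) w+m≡n ⟩
        c + shift w g n  ∎
    }
    where
    open ≡-Reasoning
    m : ℕ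
    m = n ∸ w
    w+m≡n : w + m ≡ n
    w+m≡n = m+[n∸m]≡n w≤n
    h : HasCount (Q m) (g m)
    h = hQ m w+m≡n
    disjoint : ∀ {κ} → ¬ (κ ∈ elements hP × κ ∈ map (x ∷_) (elements h))
    disjoint (κ∈ , κ∈′) with ∈-map⁻ (x ∷_) κ∈′
    ... | _ , _ , refl = fresh adj (sound hP κ∈)
    sound′ : ∀ {κ} → κ ∈ elements hP ⊎ κ ∈ map (x ∷_) (elements h) → R n κ
    sound′ (inj₁ κ∈) = keep adj (sound hP κ∈)
    sound′ {κ} (inj₂ κ∈) with ∈-map⁻ (x ∷_) κ∈
    ... | _ , κ′∈ , refl = subst (λ i → R i κ) w+m≡n (cons adj (sound h κ′∈))
    complete′ : ∀ {i κ} → i ≡ n → Decomposition x w P Q i κ → κ ∈ elements hP ++ map (x ∷_) (elements h)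
    complete′ refl (old p) = ∈-++⁺ˡ (complete hP p)
    complete′ i≡n (new {n = m′} {κ} q) = ∈-++⁺ʳ (elements hP)
      (∈-map⁺ (x ∷_) (complete h (subst (λ l → Q l κ) (+-cancelˡ-≡ w m′ m (trans i≡n (sym w+m≡n))) q)))

_Counts_ : {X : Set} → Series → (ℕ → List X → Set) → Set
f Counts P = ∀ n → HasCount (P n) (f n)

δ-counts : ∀ {X : Set} {P : ℕ → List X → Set} → P 0 [] →
           (∀ {n κ} → P n κ → n ≡ 0 × κ ≡ []) → δ Counts P
δ-counts {P = P} p₀ only zero = record
  { elements = [] ∷ []
  ; unique   = [] ∷ []
  ; sound    = sound₀
  ; complete = here ∘ proj₂ ∘ only
  ; size≡    = refl
  }
  where
  sound₀ : ∀ {κ} → κ ∈ [] ∷ [] → P 0 κ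
  sound₀ (here refl) = p₀
δ-counts p₀ only (suc n) = record
  { elements = []
  ; unique   = []
  ; sound    = λ ()
  ; complete = λ p → ⊥-elim (1+n≢0 (proj₁ (only p)))
  ; size≡    = refl
  }

times1+-counts : ∀ {X : Set} {x : X} {w P R f} →
                 Adjoins x w P P R → f Counts P → times1+ w f Counts R
times1+-counts adj hP n = HasCount-adjoins adj (hP n) λ m _ → hP m

geom-counts : ∀ {X : Set} {x : X} {w P R f} .{{_ : NonZero w}} →
              Adjoins x w P R R → f Counts P → geom w f Counts R
geom-counts {w = w} {P} {R} {f} adj hP n = go (suc n) n ≤-refl
  where
  go : ∀ u n → n < u → HasCount (R n) (geom w f n)
  go (suc u) n (s≤s n≤u) = subst (HasCount (R n)) (sym (geom-unfold w f n))
    (HasCount-adjoins adj (hP n) λ m w+m≡n →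
      go u m (≤-trans (≤-trans (+-monoˡ-≤ m (>-nonZero⁻¹ w)) (≤-reflexive w+m≡n)) n≤u))

Linked-∷ : ∀ {X : Set} {R : X → X → Set} {x : X} {xs} → All (R x) xs → Linked R xs → Linked R (x ∷ xs)
Linked-∷ []      []        = [-]
Linked-∷ (r ∷ _) xs@([-])   = r ∷ xs
Linked-∷ (r ∷ _) xs@(_ ∷ _) = r ∷ xs

parts≤sum : ∀ π → All (_≤ sum π) π
parts≤sum []      = []
parts≤sum (p ∷ π) = m≤m+n p (sum π) ∷ All.map (λ q≤ → ≤-trans q≤ (m≤n+m (sum π) p)) (parts≤sum π)

odd-1+2* : ∀ k → Odd (1 + 2 * k)
odd-1+2* k 2∣ with ∣1⇒≡1 (∣m+n∣m⇒∣n (subst (2 ∣_) (+-comm 1 (2 * k)) 2∣) (m∣m*n k))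
... | ()

IsPartition-∷ : ∀ {b n π} → All (_≤ b) π → IsPartition n π → 0 < b → IsPartition (b + n) (b ∷ π)
IsPartition-∷ ≤b (lin , pos , sum≡) 0<b = Linked-∷ ≤b lin , 0<b ∷ pos , cong (_ +_) sum≡

IsPartition-tail : ∀ {b n π} → IsPartition (b + n) (b ∷ π) → IsPartition n π
IsPartition-tail (lin , _ ∷ pos , sum≡) = Linked.tail lin , pos , +-cancelˡ-≡ _ _ _ sum≡

-- Partitions with distinct odd parts

PodUpTo : ℕ → ℕ → List ℕ → Set
PodUpTo b n π = IsPodPartition n π × All (_≤ b) π

PodUpTo-0 : ∀ {n π} → PodUpTo 0 n π → n ≡ 0 × π ≡ []
PodUpTo-0 {π = []}    (((_ , _ , refl) , _) , _)           = refl , refl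
PodUpTo-0 {π = _ ∷ _} (((_ , 0<p ∷ _ , _) , _) , p≤0 ∷ _) = ⊥-elim (<⇒≱ 0<p p≤0)

module _ {b : ℕ} where

  PodUpTo-suc : ∀ {n π} → PodUpTo b n π → PodUpTo (suc b) n π
  PodUpTo-suc (p , ≤b) = p , All.map m≤n⇒m≤1+n ≤b

  PodUpTo-fresh : ∀ {n π} → ¬ PodUpTo b n (suc b ∷ π)
  PodUpTo-fresh (_ , b<b ∷ _) = <-irrefl refl b<b

  -- The head of a decreasing list bounds the rest, so only the head has to be compared with b + 1.
  -- What may follow a head b + 1 is left open here, since it depends on the parity of b + 1.
  PodUpTo-split : ∀ {n π} → PodUpTo (suc b) n π →
    Decomposition (suc b) (suc b) (PodUpTo b) (λ m π′ → PodUpTo (suc b) (suc b + m) (suc b ∷ π′)) n π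
  PodUpTo-split {π = []} (p , _) = old (p , [])
  PodUpTo-split {π = x ∷ π} (p@((lin , _ , refl) , _) , ≤b@(x≤ ∷ _)) with m≤n⇒m<n∨m≡n x≤
  ... | inj₁ (s≤s x≤b) = old (p , Linked⇒All (flip ≤-trans) x≤b lin)
  ... | inj₂ refl      = new (p , ≤b)

  PodUpTo-odd : Odd (suc b) → Adjoins (suc b) (suc b) (PodUpTo b) (PodUpTo b) (PodUpTo (suc b))
  PodUpTo-odd odd = record
    { keep  = PodUpTo-suc
    ; cons  = λ where
        p@((part , uniq) , ≤b) →
          let _ , ≤sb = PodUpTo-suc p in
          (IsPartition-∷ ≤sb part (s≤s z≤n) ,
           subst Unique (sym (filter-accept odd? odd))
             (All.filter⁺ odd? (All.map (λ y≤b → λ where refl → <-irrefl refl y≤b) ≤b) ∷ uniq)) ,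
          ≤-refl ∷ ≤sb
    ; split = Decomposition-map tail ∘ PodUpTo-split
    ; fresh = PodUpTo-fresh
    }
    where
    distinct : ∀ {π} → Unique (filter odd? (suc b ∷ π)) → All (suc b ≢_) (filter odd? π) × Unique (filter odd? π)
    distinct u with subst Unique (filter-accept odd? odd) u
    ... | ≢ ∷ u′ = ≢ , u′
    -- Distinctness is known only among the odd parts, but a second copy of b + 1 would be odd and
    -- hence among them.
    smaller : ∀ {π} → All (suc b ≢_) (filter odd? π) → All (_≤ suc b) π → All (_≤ b) π
    smaller ≢s ≤sb = All.tabulate λ {y} y∈ → ≤-pred (≤∧≢⇒< (All.lookup ≤sb y∈) λ where
      refl → All.lookup ≢s (∈-filter⁺ odd? y∈ odd) refl)
    tail : ∀ {n π} → PodUpTo (suc b) (suc b + n) (suc b ∷ π) → PodUpTo b n π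
    tail ((part , uniq) , _ ∷ ≤sb) =
      let ≢s , uniq′ = distinct uniq in (IsPartition-tail part , uniq′) , smaller ≢s ≤sb

  PodUpTo-even : 2 ∣ suc b → Adjoins (suc b) (suc b) (PodUpTo b) (PodUpTo (suc b)) (PodUpTo (suc b))
  PodUpTo-even even = record
    { keep  = PodUpTo-suc
    ; cons  = λ where
        ((part , uniq) , ≤sb) →
          (IsPartition-∷ ≤sb part (s≤s z≤n) , subst Unique (sym (filter-reject odd? (λ odd → odd even))) uniq) ,
          ≤-refl ∷ ≤sb
    ; split = Decomposition-map tail ∘ PodUpTo-split
    ; fresh = PodUpTo-fresh
    }
    where
    tail : ∀ {n π} → PodUpTo (suc b) (suc b + n) (suc b ∷ π) → PodUpTo (suc b) n π
    tail ((part , uniq) , _ ∷ ≤sb) =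
      (IsPartition-tail part , subst Unique (filter-reject odd? (λ odd → odd even)) uniq) , ≤sb

-- Four part sizes per step: the odd ones are the pair of factors added by `oddProduct`, the even
-- ones those added by `evenSeries`.
podSeries : ℕ → Series
podSeries zero    = δ
podSeries (suc m) =
  geom (4 + 4 * m) (times1+ (3 + 4 * m) (geom (2 + 4 * m) (times1+ (1 + 4 * m) (podSeries m))))

podSeries-counts : ∀ m → podSeries m Counts PodUpTo (4 * m)
podSeries-counts zero    = δ-counts ((([] , [] , refl) , []) , []) PodUpTo-0
podSeries-counts (suc m) = subst (λ b → podSeries (suc m) Counts PodUpTo b) (sym (*-suc 4 m))
  (geom-counts (PodUpTo-even (divides (2 + 2 * m) (lemma₄ m)))
    (times1+-counts (PodUpTo-odd (subst Odd (lemma₃ m) (odd-1+2* (1 + 2 * m))))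
      (geom-counts (PodUpTo-even (divides (1 + 2 * m) (lemma₂ m)))
        (times1+-counts (PodUpTo-odd (subst Odd (lemma₁ m) (odd-1+2* (2 * m))))
          (podSeries-counts m)))))
  where
  lemma₁ : ∀ m → 1 + 2 * (2 * m) ≡ 1 + 4 * m
  lemma₁ = solve-∀
  lemma₂ : ∀ m → 2 + 4 * m ≡ (1 + 2 * m) * 2
  lemma₂ = solve-∀
  lemma₃ : ∀ m → 1 + 2 * (1 + 2 * m) ≡ 3 + 4 * m
  lemma₃ = solve-∀
  lemma₄ : ∀ m → 4 + 4 * m ≡ (2 + 2 * m) * 2
  lemma₄ = solve-∀

pod≡podSeries : ∀ m n → n ≤ 4 * m → pod n ≡ podSeries m n
pod≡podSeries m n n≤4m = HasCount-unique
  (record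
    { elements = podPartitions n
    ; unique   = podPartitions-unique n
    ; sound    = λ π∈ → proj₂ (∈-filter⁻ (isPodPartition? n) {xs = lists _ n} π∈)
    ; complete = ∈-podPartitions
    ; size≡    = refl
    })
  (HasCount-⇔ proj₁ bounded (podSeries-counts m n))
  where
  bounded : ∀ {π} → IsPodPartition n π → PodUpTo (4 * m) n π
  bounded {π} p@((_ , _ , refl) , _) = p , All.map (λ ≤n → ≤-trans ≤n n≤4m) (parts≤sum π)

-- Cubic partitions

≽-refl : ∀ x → x ≽ x
≽-refl x = inj₂ (refl , ≤-refl)

≽-trans : ∀ {x y z} → x ≽ y → y ≽ z → x ≽ z
≽-trans (inj₁ p)          (inj₁ q)          = inj₁ (<-trans q p)
≽-trans (inj₁ p)          (inj₂ (refl , _)) = inj₁ p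
≽-trans (inj₂ (refl , _)) (inj₁ q)          = inj₁ q
≽-trans (inj₂ (refl , p)) (inj₂ (refl , q)) = inj₂ (refl , ≤-trans q p)

≽⇒size≥ : ∀ {x y} → x ≽ y → size x ≥ size y
≽⇒size≥ (inj₁ p)          = <⇒≤ p
≽⇒size≥ (inj₂ (refl , _)) = ≤-refl

CubicUpTo : ColouredPart → ℕ → List ColouredPart → Set
CubicUpTo x n κ = IsCubicPartition n κ × All (x ≽_) κ

-- y is the immediate successor of x in the total order (b, 0), (b, 1), (b + 1, 0), ..., so raising
-- the bound from x to y makes y the only new part.
record _Covers_ (y x : ColouredPart) : Set where
  field
    above : ∀ {z} → x ≽ z → y ≽ z
    gap   : ∀ {z} → y ≽ z → z ≡ y ⊎ x ≽ z
    not-above : ¬ x ≽ y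

open _Covers_

colour-covers : ∀ b → (b , suc zero) Covers (b , zero)
colour-covers b = record
  { above  = λ where
      (inj₁ p)          → inj₁ p
      (inj₂ (refl , p)) → inj₂ (refl , ≤-trans p z≤n)
  ; gap    = λ where
      (inj₁ p)                         → inj₂ (inj₁ p)
      {_ , zero}     (inj₂ (refl , _)) → inj₂ (inj₂ (refl , z≤n))
      {_ , suc zero} (inj₂ (refl , _)) → inj₁ refl
  ; not-above = λ where
      (inj₁ p)       → <-irrefl refl p
      (inj₂ (_ , ()))
  }

size-covers : ∀ b → (suc b , zero) Covers (b , suc zero)
size-covers b = record
  { above  = λ x≽z → inj₁ (s≤s (≽⇒size≥ x≽z))
  ; gap    = λ where
      (inj₁ (s≤s m≤b))             → inj₂ (below (m≤n⇒m<n∨m≡n m≤b))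
      {_ , zero} (inj₂ (refl , _)) → inj₁ refl
  ; not-above = λ where
      (inj₁ p)        → <-asym p ≤-refl
      (inj₂ (() , _))
  }
  where
  below : ∀ {m c} → m < b ⊎ m ≡ b → (b , suc zero) ≽ (m , c)
  below         (inj₁ m<b)  = inj₁ m<b
  below {c = c} (inj₂ refl) = inj₂ (refl , Fin.toℕ≤pred[n] c)

module _ {x y} (cov : y Covers x) where

  CubicUpTo-split : ∀ {n κ} → CubicUpTo y n κ →
    Decomposition y (size y) (CubicUpTo x) (λ m κ′ → CubicUpTo y (size y + m) (y ∷ κ′)) n κ
  CubicUpTo-split {κ = []} (p , _) = old (p , [])
  CubicUpTo-split {κ = z ∷ κ} (p@(lin , (_ , _ , refl) , _) , y≽@(y≽z ∷ _)) with gap cov y≽z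
  ... | inj₂ x≽z  = old (p , Linked⇒All ≽-trans x≽z lin)
  ... | inj₁ refl = new (p , y≽)

  CubicUpTo-keep : ∀ {n κ} → CubicUpTo x n κ → CubicUpTo y n κ
  CubicUpTo-keep (p , x≽) = p , All.map (above cov) x≽

  CubicUpTo-adjoins : 0 < size y → Admissible y →
                      Adjoins y (size y) (CubicUpTo x) (CubicUpTo y) (CubicUpTo y)
  CubicUpTo-adjoins 0<y adm = record
    { keep  = CubicUpTo-keep
    ; cons  = λ where
        ((lin , part , adms) , y≽) →
          (Linked-∷ y≽ lin , IsPartition-∷ (All.map⁺ (All.map ≽⇒size≥ y≽)) part 0<y , adm ∷ adms) ,
          ≽-refl y ∷ y≽
    ; split = Decomposition-map tail ∘ CubicUpTo-split
    ; fresh = λ where (_ , x≽y ∷ _) → not-above cov x≽y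
    }
    where
    tail : ∀ {n κ} → CubicUpTo y (size y + n) (y ∷ κ) → CubicUpTo y n κ
    tail ((lin , part , _ ∷ adms) , _ ∷ y≽) = (Linked.tail lin , IsPartition-tail part , adms) , y≽

  CubicUpTo-inadmissible : ∀ {f} → ¬ Admissible y → f Counts CubicUpTo x → f Counts CubicUpTo y
  CubicUpTo-inadmissible ¬adm h n = HasCount-⇔ CubicUpTo-keep back (h n)
    where
    back : ∀ {κ} → CubicUpTo y n κ → CubicUpTo x n κ
    back p with CubicUpTo-split p
    ... | old q                       = q
    ... | new ((_ , _ , adm ∷ _) , _) = ⊥-elim (¬adm adm)

CubicUpTo-0 : ∀ {c n κ} → CubicUpTo (0 , c) n κ → n ≡ 0 × κ ≡ []
CubicUpTo-0 {κ = []}    ((_ , (_ , _ , refl) , _) , _)           = refl , refl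
CubicUpTo-0 {κ = _ ∷ _} ((_ , (_ , 0<p ∷ _ , _) , _) , 0≽p ∷ _) = ⊥-elim (<⇒≱ 0<p (≽⇒size≥ 0≽p))

cubicSeries : ℕ → Series
cubicSeries zero    = δ
cubicSeries (suc m) = geom (2 + 2 * m) (geom (2 + 2 * m) (geom (1 + 2 * m) (cubicSeries m)))

-- Four successor steps lead from the last part of size 2m to the last of size 2m + 2. The step to
-- the odd size in its second colour is inadmissible and gives no factor, which leaves three.
cubicSeries-counts : ∀ m → cubicSeries m Counts CubicUpTo (2 * m , suc zero)
cubicSeries-counts zero    = δ-counts (([] , ([] , [] , refl) , []) , []) CubicUpTo-0
cubicSeries-counts (suc m) = subst (λ b → cubicSeries (suc m) Counts CubicUpTo (b , suc zero)) (sym (*-suc 2 m))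
  (geom-counts (CubicUpTo-adjoins (colour-covers (2 + 2 * m)) (s≤s z≤n) (λ odd → ⊥-elim (odd even)))
    (geom-counts (CubicUpTo-adjoins (size-covers (1 + 2 * m)) (s≤s z≤n) (λ _ → refl))
      (CubicUpTo-inadmissible (colour-covers (1 + 2 * m)) (λ adm → Fin.0≢1+n (sym (adm (odd-1+2* m))))
        (geom-counts (CubicUpTo-adjoins (size-covers (2 * m)) (s≤s z≤n) (λ _ → refl))
          (cubicSeries-counts m)))))
  where
  even : 2 ∣ 2 + 2 * m
  even = divides (1 + m) (lemma m)
    where
    lemma : ∀ m → 2 + 2 * m ≡ (1 + m) * 2
    lemma = solve-∀

a≡cubicSeries : ∀ m n → n ≤ 2 * m → a n ≡ cubicSeries m n
a≡cubicSeries m n n≤2m = HasCount-unique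
  (record
    { elements = cubicPartitions n
    ; unique   = cubicPartitions-unique n
    ; sound    = λ κ∈ → proj₂ (∈-filter⁻ (isCubicPartition? n) {xs = lists _ n} κ∈)
    ; complete = ∈-cubicPartitions
    ; size≡    = refl
    })
  (HasCount-⇔ proj₁ bounded (cubicSeries-counts m n))
  where
  ≤⇒≽ : ∀ {z} → size z ≤ 2 * m → (2 * m , suc zero) ≽ z
  ≤⇒≽ {_ , c} z≤ with m≤n⇒m<n∨m≡n z≤
  ... | inj₁ z<   = inj₁ z<
  ... | inj₂ refl = inj₂ (refl , Fin.toℕ≤pred[n] c)
  bounded : ∀ {κ} → IsCubicPartition n κ → CubicUpTo (2 * m , suc zero) n κ
  bounded {κ} p@(_ , (_ , _ , refl) , _) =
    p , All.map (λ z≤n → ≤⇒≽ (≤-trans z≤n n≤2m)) (All.map⁻ (parts≤sum (map size κ)))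

-- Comparison of the two products

evenSeries : ℕ → Series
evenSeries zero    = δ
evenSeries (suc m) = geom (4 + 4 * m) (geom (2 + 4 * m) (evenSeries m))

geom-oddProduct : ∀ k .{{_ : NonZero k}} m f → geom k (oddProduct m f) ≗ oddProduct m (geom k f)
geom-oddProduct k zero    f n = refl
geom-oddProduct k (suc m) f n = begin
  geom k (times1+ (3 + 4 * m) (times1+ (1 + 4 * m) (oddProduct m f))) n
    ≡⟨ geom-times1+ k (3 + 4 * m) _ n ⟩
  times1+ (3 + 4 * m) (geom k (times1+ (1 + 4 * m) (oddProduct m f))) n
    ≡⟨ times1+-cong (3 + 4 * m) (geom-times1+ k (1 + 4 * m) _) n ⟩
  times1+ (3 + 4 * m) (times1+ (1 + 4 * m) (geom k (oddProduct m f))) n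
    ≡⟨ times1+-cong (3 + 4 * m) (times1+-cong (1 + 4 * m) (geom-oddProduct k m f)) n ⟩
  oddProduct (suc m) (geom k f) n  ∎
  where open ≡-Reasoning

-- Enumeration by largest part interleaves odd and even factors; commutation moves all even ones
-- inside.
podSeries-oddProduct : ∀ m → podSeries m ≗ oddProduct m (evenSeries m)
podSeries-oddProduct zero    n = refl
podSeries-oddProduct (suc m) n = begin
  geom k₄ (times1+ k₃ (geom k₂ (times1+ k₁ (podSeries m)))) n
    ≡⟨ geom-cong k₄ (times1+-cong k₃ (geom-times1+ k₂ k₁ (podSeries m))) n ⟩
  geom k₄ (times1+ k₃ (times1+ k₁ (geom k₂ (podSeries m)))) n
    ≡⟨ geom-times1+ k₄ k₃ _ n ⟩
  times1+ k₃ (geom k₄ (times1+ k₁ (geom k₂ (podSeries m)))) n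
    ≡⟨ times1+-cong k₃ (geom-times1+ k₄ k₁ _) n ⟩
  times1+ k₃ (times1+ k₁ (geom k₄ (geom k₂ (podSeries m)))) n
    ≡⟨ times1+-cong k₃ (times1+-cong k₁ inner) n ⟩
  oddProduct (suc m) (evenSeries (suc m)) n  ∎
  where
  open ≡-Reasoning
  k₁ = 1 + 4 * m
  k₂ = 2 + 4 * m
  k₃ = 3 + 4 * m
  k₄ = 4 + 4 * m
  inner : geom k₄ (geom k₂ (podSeries m)) ≗ oddProduct m (evenSeries (suc m))
  inner i = begin
    geom k₄ (geom k₂ (podSeries m)) i
      ≡⟨ geom-cong k₄ (geom-cong k₂ (podSeries-oddProduct m)) i ⟩
    geom k₄ (geom k₂ (oddProduct m (evenSeries m))) i
      ≡⟨ geom-cong k₄ (geom-oddProduct k₂ m (evenSeries m)) i ⟩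
    geom k₄ (oddProduct m (geom k₂ (evenSeries m))) i
      ≡⟨ geom-oddProduct k₄ m _ i ⟩
    oddProduct m (evenSeries (suc m)) i  ∎

-- dilate f is f (q^2).
dilate : Series → Series
dilate f zero          = f 0
dilate f (suc zero)    = 0
dilate f (suc (suc n)) = dilate (λ i → f (suc i)) n

dilate-local : ∀ n {f g} → (∀ i → 2 * i ≤ n → f i ≡ g i) → dilate f n ≡ dilate g n
dilate-local zero          f≡g = f≡g 0 z≤n
dilate-local (suc zero)    f≡g = refl
dilate-local (suc (suc n)) f≡g = dilate-local n λ i 2i≤n →
  f≡g (suc i) (≤-trans (≤-reflexive (*-suc 2 i)) (s≤s (s≤s 2i≤n)))

dilate-⊕ : ∀ f g → dilate (f ⊕ g) ≗ dilate f ⊕ dilate g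
dilate-⊕ f g zero          = refl
dilate-⊕ f g (suc zero)    = refl
dilate-⊕ f g (suc (suc n)) = dilate-⊕ (λ i → f (suc i)) (λ i → g (suc i)) n

dilate-shift : ∀ k f → dilate (shift k f) ≗ shift (2 * k) (dilate f)
dilate-shift zero    f n = dilate-local n λ i _ → refl
dilate-shift (suc k) f n = trans (go n) (cong (λ i → shift i (dilate f) n) (sym (*-suc 2 k)))
  where
  go : ∀ n → dilate (shift (suc k) f) n ≡ shift (2 + 2 * k) (dilate f) n
  go zero          = refl
  go (suc zero)    = refl
  go (suc (suc n)) = trans (dilate-local n λ i _ → refl) (dilate-shift k f n)

dilate-geom : ∀ k .{{_ : NonZero k}} .{{_ : NonZero (2 * k)}} f → dilate (geom k f) ≗ geom (2 * k) (dilate f)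
dilate-geom k f = geom-unique (2 * k) λ n → begin
  dilate (geom k f) n                               ≡⟨ dilate-local n (λ i _ → geom-unfold k f i) ⟩
  dilate (f ⊕ shift k (geom k f)) n                 ≡⟨ dilate-⊕ f _ n ⟩
  dilate f n + dilate (shift k (geom k f)) n        ≡⟨ cong (dilate f n +_) (dilate-shift k (geom k f) n) ⟩
  dilate f n + shift (2 * k) (dilate (geom k f)) n  ∎
  where open ≡-Reasoning

dilate-geom′ : ∀ j k .{{_ : NonZero j}} .{{_ : NonZero k}} {f g} →
               2 * j ≡ k → dilate f ≗ g → dilate (geom j f) ≗ geom k g
dilate-geom′ j k {f} refl eq n = trans (dilate-geom j f n) (geom-cong (2 * j) eq n)

geom-gaussLimit : ∀ k .{{_ : NonZero k}} m f → geom k (gaussLimit f m) ≗ gaussLimit (geom k f) m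
geom-gaussLimit k zero    f n = refl
geom-gaussLimit k (suc m) f n =
  trans (geom-geom k (4 + 4 * m) (gaussLimit f m) n) (geom-cong (4 + 4 * m) (geom-gaussLimit k m f) n)

-- Under q → q^2 a step contributes 1 / (1 - q^(4m+2)) and two copies of 1 / (1 - q^(4m+4)). One
-- copy joins the former as the next step of `evenSeries`; the other is the next factor of
-- `gaussLimit`.
dilate-cubicSeries : ∀ m → dilate (cubicSeries m) ≗ gaussLimit (evenSeries m) m
dilate-cubicSeries zero    zero          = refl
dilate-cubicSeries zero    (suc zero)    = refl
dilate-cubicSeries zero    (suc (suc n)) = dilate-0 n
  where
  dilate-0 : ∀ n → dilate (λ _ → 0) n ≡ 0
  dilate-0 zero          = refl
  dilate-0 (suc zero)    = refl
  dilate-0 (suc (suc n)) = dilate-0 n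
dilate-cubicSeries (suc m) n = begin
  dilate (cubicSeries (suc m)) n
    ≡⟨ dilate-geom′ (2 + 2 * m) k₄ (lemma₄ m)
         (dilate-geom′ (2 + 2 * m) k₄ (lemma₄ m)
           (dilate-geom′ (1 + 2 * m) k₂ (lemma₂ m) (dilate-cubicSeries m))) n ⟩
  geom k₄ (geom k₄ (geom k₂ (gaussLimit (evenSeries m) m))) n
    ≡⟨ geom-cong k₄ (geom-cong k₄ (geom-gaussLimit k₂ m _)) n ⟩
  geom k₄ (geom k₄ (gaussLimit (geom k₂ (evenSeries m)) m)) n
    ≡⟨ geom-cong k₄ (geom-gaussLimit k₄ m _) n ⟩
  gaussLimit (evenSeries (suc m)) (suc m) n  ∎
  where
  open ≡-Reasoning
  k₂ = 2 + 4 * m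
  k₄ = 4 + 4 * m
  lemma₂ : ∀ m → 2 * (1 + 2 * m) ≡ 2 + 4 * m
  lemma₂ = solve-∀
  lemma₄ : ∀ m → 2 * (2 + 2 * m) ≡ 4 + 4 * m
  lemma₄ = solve-∀

pod-triangular : ∀ n → pod n ≡ ∑ (1 + 2 * (2 * n)) λ j → shift (triangular j) (dilate a) n
pod-triangular n = begin
  pod n
    ≡⟨ pod≡podSeries m n (≤-trans (m≤m+n n _) (≤-reflexive (lemma₈ n))) ⟩
  podSeries m n
    ≡⟨ podSeries-oddProduct m n ⟩
  oddProduct m (evenSeries m) n
    ≡⟨ oddProduct-triangular m (evenSeries m) n ≤-refl ⟩
  ∑ (1 + 2 * m) (λ j → shift (triangular j) (gaussLimit (evenSeries m) m) n)
    ≡⟨ ∑-cong (1 + 2 * m) (λ j _ → shift-local (triangular j) λ l eq →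
         trans (sym (dilate-cubicSeries m l)) (dilate-local l λ i 2i≤l →
           sym (a≡cubicSeries m i (bound i l (triangular j) 2i≤l eq)))) ⟩
  ∑ (1 + 2 * m) (λ j → shift (triangular j) (dilate a) n)  ∎
  where
  open ≡-Reasoning
  -- The least level that `oddProduct-triangular` accepts; the ranges n ≤ 4m and i ≤ 2m for the two
  -- counts then hold as well.
  m = 2 * n
  lemma₈ : ∀ n → n + 7 * n ≡ 4 * (2 * n)
  lemma₈ = solve-∀
  bound : ∀ i l t → 2 * i ≤ l → t + l ≡ n → i ≤ 2 * m
  bound i l t 2i≤l eq = ≤-trans (m≤m+n i (i + 0)) (≤-trans 2i≤l (≤-trans (m≤n+m l t)
    (≤-trans (≤-reflexive eq) (≤-trans (m≤m+n n _) (m≤m+n m _)))))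

-- Passage to rational arguments

j*[j+1]≡2*triangular : ∀ j → j * (j + 1) ≡ 2 * triangular j
j*[j+1]≡2*triangular zero    = refl
j*[j+1]≡2*triangular (suc j) = begin
  suc j * (suc j + 1)              ≡⟨ lemma₁ j ⟩
  j * (j + 1) + 2 * suc j          ≡⟨ cong (_+ 2 * suc j) (j*[j+1]≡2*triangular j) ⟩
  2 * triangular j + 2 * suc j     ≡⟨ lemma₂ (triangular j) j ⟩
  2 * (suc j + triangular j)       ∎
  where
  open ≡-Reasoning
  lemma₁ : ∀ j → (1 + j) * (1 + j + 1) ≡ j * (j + 1) + 2 * (1 + j)
  lemma₁ = solve-∀
  lemma₂ : ∀ t j → 2 * t + 2 * (1 + j) ≡ 2 * (1 + j + t)
  lemma₂ = solve-∀

dilate-2* : ∀ f m → dilate f (m * 2) ≡ f m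
dilate-2* f zero    = refl
dilate-2* f (suc m) = dilate-2* (λ i → f (suc i)) m

dilate-even : ∀ f l → dilate f l ≡ 0 ⊎ 2 ∣ l
dilate-even f zero          = inj₂ (divides 0 refl)
dilate-even f (suc zero)    = inj₁ refl
dilate-even f (suc (suc l)) with dilate-even (λ i → f (suc i)) l
... | inj₁ eq                = inj₁ eq
... | inj₂ (divides i refl)  = inj₂ (divides (suc i) refl)

open import Data.Integer.Base as ℤ using (+_; -[1+_])
import Data.Integer.Properties as ℤ
open import Data.Rational.Base using (ℚ; mkℚ; _/_; _-_; ↥_; ↧_; toℚᵘ; -_)
import Data.Rational.Properties as ℚ
open import Data.Rational.Unnormalised.Base as ℚᵘ using (mkℚᵘ; *≡*)
import Data.Rational.Unnormalised.Properties as ℚᵘ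
open import Data.Integer.Tactic.RingSolver using () renaming (solve-∀ to ℤ-solve-∀)

-- The fraction is l/2 in lowest terms. If its denominator exceeds 1 then l is odd and both sides
-- are 0: an even l would make the denominator divide m, against coprimality.
aℚ-half : ∀ m d l .(c : Coprime m (suc d)) → m * 2 ≡ l * suc d → aℚ (mkℚ (+ m) d c) ≡ dilate a l
aℚ-half m zero    l c eq = begin
  a m               ≡⟨ dilate-2* a m ⟨
  dilate a (m * 2)  ≡⟨ cong (dilate a) (trans eq (*-identityʳ l)) ⟩
  dilate a l        ∎
  where open ≡-Reasoning
aℚ-half m (suc d) l c eq with dilate-even a l
... | inj₁ eq₀ = sym eq₀
... | inj₂ (divides i refl) = Irrelevant.⊥-elim (2+d≢1 (c (divides i m≡ , ∣-refl)))
  where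
  2+d≢1 : 2 + d ≢ 1
  2+d≢1 ()
  swap : ∀ i x → i * 2 * x ≡ i * x * 2
  swap = solve-∀
  m≡ : m ≡ i * (2 + d)
  m≡ = *-cancelʳ-≡ m _ 2 (trans eq (swap i (2 + d)))

-- The hypothesis says that q = (n − t) / 2.
aℚ-shift : ∀ q n t → ↥ q ℤ.* + 2 ℤ.+ + t ℤ.* ↧ q ≡ + n ℤ.* ↧ q → aℚ q ≡ shift t (dilate a) n
aℚ-shift (mkℚ (+ m) d c) n t eq = begin
  aℚ (mkℚ (+ m) d c)          ≡⟨ aℚ-half m d (n ∸ t) c 2m≡ ⟩
  dilate a (n ∸ t)            ≡⟨ shift-+ t (dilate a) (n ∸ t) ⟨
  shift t (dilate a) (t + (n ∸ t))  ≡⟨ cong (shift t (dilate a)) (m+[n∸m]≡n t≤n) ⟩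
  shift t (dilate a) n        ∎
  where
  open ≡-Reasoning
  eqℕ : m * 2 + t * suc d ≡ n * suc d
  eqℕ = ℤ.+-injective (begin
    + (m * 2 + t * suc d)                ≡⟨ ℤ.pos-+ (m * 2) (t * suc d) ⟩
    + (m * 2) ℤ.+ + (t * suc d)          ≡⟨ cong₂ ℤ._+_ (ℤ.pos-* m 2) (ℤ.pos-* t (suc d)) ⟩
    + m ℤ.* + 2 ℤ.+ + t ℤ.* + suc d      ≡⟨ eq ⟩
    + n ℤ.* + suc d                      ≡⟨ ℤ.pos-* n (suc d) ⟨
    + (n * suc d)                        ∎)
  t≤n : t ≤ n
  t≤n = *-cancelʳ-≤ t n (suc d) (m+n≤o⇒n≤o (m * 2) (≤-reflexive eqℕ))
  2m≡ : m * 2 ≡ (n ∸ t) * suc d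
  2m≡ = trans (sym (m+n∸n≡m (m * 2) (t * suc d)))
          (trans (cong (_∸ t * suc d) eqℕ) (sym (*-distribʳ-∸ (suc d) n t)))
-- A negative numerator forces n < t, so the shifted series is 0 at n, matching the default value of
-- `aℚ`.
aℚ-shift (mkℚ -[1+ m ] d c) n t eq = sym (shift-< (dilate a) (*-cancelʳ-< (suc d) n t
  (ℤ.drop‿+<+ (begin-strict
    + (n * suc d)                              ≡⟨ ℤ.pos-* n (suc d) ⟩
    + n ℤ.* + suc d                            ≡⟨ eq ⟨
    -[1+ m ] ℤ.* + 2 ℤ.+ + t ℤ.* + suc d       <⟨ ℤ.+-monoˡ-< (+ t ℤ.* + suc d) ℤ.-<+ ⟩
    + 0 ℤ.+ + t ℤ.* + suc d                    ≡⟨ ℤ.+-identityˡ _ ⟩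
    + t ℤ.* + suc d                            ≡⟨ ℤ.pos-* t (suc d) ⟨
    + (t * suc d)                              ∎))))
  where open ℤ.≤-Reasoning

aℚ-term : ∀ n j → aℚ ((+ n / 2) - (+ (j * (j + 1)) / 4)) ≡ shift (triangular j) (dilate a) n
aℚ-term n j = aℚ-shift q n (triangular j) (numerators q (begin
  toℚᵘ q
    ≈⟨ ℚ.toℚᵘ-homo-+ (+ n / 2) (- x) ⟩
  toℚᵘ (+ n / 2) ℚᵘ.+ toℚᵘ (- x)
    ≈⟨ ℚᵘ.+-cong (ℚ.toℚᵘ-fromℚᵘ (mkℚᵘ (+ n) 1))
         (ℚᵘ.≃-trans (ℚ.toℚᵘ-homo‿- x) (ℚᵘ.-‿cong (ℚ.toℚᵘ-fromℚᵘ (mkℚᵘ (+ (j * (j + 1))) 3)))) ⟩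
  mkℚᵘ (+ n) 1 ℚᵘ.- mkℚᵘ (+ (j * (j + 1))) 3  ∎))
  where
  open ℚᵘ.≃-Reasoning
  x q : ℚ
  x = + (j * (j + 1)) / 4
  q = (+ n / 2) - x
  t = triangular j
  -- Stated for an arbitrary q, which can be matched as `mkℚ p d _`; the actual difference is
  -- normalised by a gcd and does not compute.
  numerators : ∀ q → toℚᵘ q ℚᵘ.≃ mkℚᵘ (+ n) 1 ℚᵘ.- mkℚᵘ (+ (j * (j + 1))) 3 →
               ↥ q ℤ.* + 2 ℤ.+ + t ℤ.* ↧ q ≡ + n ℤ.* ↧ q
  -- The unreduced difference has denominator 2 · 4 = 8, so `eq` is four times the desired equation
  -- once j(j+1) is written as 2t.
  numerators (mkℚ p d _) (*≡* eq) = ℤ.*-cancelˡ-≡ (+ 4) _ _ (≡R.begin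
    + 4 ℤ.* (p ℤ.* + 2 ℤ.+ + t ℤ.* D)
      ≡R.≡⟨ lemma₁ p (+ t) D ⟩
    p ℤ.* + 8 ℤ.+ + 4 ℤ.* + t ℤ.* D
      ≡R.≡⟨ cong (ℤ._+ + 4 ℤ.* + t ℤ.* D) eq ⟩
    (+ n ℤ.* + 4 ℤ.+ ℤ.- (+ (j * (j + 1))) ℤ.* + 2) ℤ.* D ℤ.+ + 4 ℤ.* + t ℤ.* D
      ≡R.≡⟨ cong (λ y → (+ n ℤ.* + 4 ℤ.+ ℤ.- y ℤ.* + 2) ℤ.* D ℤ.+ + 4 ℤ.* + t ℤ.* D)
            (trans (cong +_ (j*[j+1]≡2*triangular j)) (ℤ.pos-* 2 t)) ⟩
    (+ n ℤ.* + 4 ℤ.+ ℤ.- (+ 2 ℤ.* + t) ℤ.* + 2) ℤ.* D ℤ.+ + 4 ℤ.* + t ℤ.* D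
      ≡R.≡⟨ lemma₂ (+ n) (+ t) D ⟩
    + 4 ℤ.* (+ n ℤ.* D)  ≡R.∎)
    where
    module ≡R = ≡-Reasoning
    D = + suc d
    lemma₁ : ∀ p t D → + 4 ℤ.* (p ℤ.* + 2 ℤ.+ t ℤ.* D) ≡ p ℤ.* + 8 ℤ.+ + 4 ℤ.* t ℤ.* D
    lemma₁ = ℤ-solve-∀
    lemma₂ : ∀ n t D → (n ℤ.* + 4 ℤ.+ ℤ.- (+ 2 ℤ.* t) ℤ.* + 2) ℤ.* D ℤ.+ + 4 ℤ.* t ℤ.* D ≡ + 4 ℤ.* (n ℤ.* D)
    lemma₂ = ℤ-solve-∀

theorem4p15 : (n : ℕ) → Σ∞ (λ j → aℚ ((+ n / 2) - (+ (j * (j + 1)) / 4))) ≈ pod n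
-- The witness is the length of the sum in `pod-triangular`; any later j has `triangular j` ≥ j > n
-- and contributes 0.
theorem4p15 n = 1 + 2 * (2 * n) , λ M N≤M → begin
  ∑ M (λ j → aℚ ((+ n / 2) - (+ (j * (j + 1)) / 4)))
    ≡⟨ ∑-cong M (λ j _ → aℚ-term n j) ⟩
  ∑ M (λ j → shift (triangular j) (dilate a) n)
    ≡⟨ ∑-truncate (λ j → shift (triangular j) (dilate a) n) N≤M (λ j N≤j →
         shift-< (dilate a) (≤-trans (s≤s n≤4n) (≤-trans N≤j (n≤triangular j)))) ⟩
  ∑ (1 + 2 * (2 * n)) (λ j → shift (triangular j) (dilate a) n)
    ≡⟨ pod-triangular n ⟨
  pod n  ∎
  where
  open ≡-Reasoning
  n≤4n : n ≤ 2 * (2 * n)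
  n≤4n = ≤-trans (m≤m+n n (n + 0)) (m≤m+n (2 * n) (2 * n + 0))
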